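{- Let $\mathcal{K}=(AP,W,\delta,\mu,w_0)$ be a finite Kripke structure, $k\in\mathbb{N}$, and $\rho$ a track in $\mathrm{Trk}_{\mathcal{K}}$. If $|\rho|>\tau(|W|,k)$, where $$\tau(|W|,k)=\min\big\{1+(1+|W|)^{2k+4}+|W|,\; 1+(k+3)^{|W|^2+1}+|W|\big\},$$ then there exists another track in $\mathrm{Trk}_{\mathcal{K}}$, whose length is less than or equal to $\tau(|W|,k)$, associated with the same $B_k$-descriptor as $\rho$.
   Context: A finite Kripke structure is a tuple $\mathcal{K}=(AP,W,\delta,\mu,w_0)$ with $AP$ a finite set of proposition letters, $W$ a finite set of states, $\delta\subseteq W\times W$ a left-total relation, $\mu:W\to 2^{AP}$ a labelling function, and $w_0\in W$ the initial state. A track over $\mathcal{K}$ is a finite sequence $\rho=v_0\cdots v_n$ of states with $n\ge 1$ and $(v_i,v_{i+1})\in\delta$ for all $0\le i<n$; $\mathrm{Trk}_{\mathcal{K}}$ is the set of all tracks; the length is $|\rho|=n+1$; $\mathrm{fst}(\rho)=v_0$, $\mathrm{lst}(\rho)=v_n$, $\mathrm{intstates}(\rho)=\{v_1,\dots,v_{n-1}\}$, $\rho(i,j)=v_i\cdots v_j$, and $\mathrm{Pref}(\rho)=\{\rho(0,i)\mid 1\le i\le|\rho|-2\}$ (proper prefixes of length at least 2). The $B_k$-descriptor for a track $\rho$ is the rooted tree, with nodes labelled in $W\times 2^W\times W$, defined inductively: its root is labelled $(\mathrm{fst}(\rho),\mathrm{intstates}(\rho),\mathrm{lst}(\rho))$;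 for $k=0$ it has only the root; for $k>0$ the set of subtrees rooted at the children of the root is exactly the set of $B_{k-1}$-descriptors of the tracks $\rho'\in\mathrm{Pref}(\rho)$, with no two distinct children of the root having isomorphic (as labelled trees) subtrees. Equality of descriptors is up to isomorphism of labelled rooted trees. -}

module Defs where

open import Data.Fin.Base using (Fin; toℕ)
open import Data.Fin.Properties using (toℕ<n)
open import Data.Fin.Subset using (Subset; ⁅_⁆; ⋃)
open import Data.List.Base using (List; [])
open import Data.List.Relation.Binary.Permutation.Homogeneous using (Permutation)
open import Data.List.Relation.Unary.All using (All)
open import Data.List.Relation.Unary.AllPairs using (AllPairs)
open import Data.List.Relation.Unary.Any using (Any)
open import Data.Nat.Base using (ℕ; zero; suc; _+_; _*_; _^_; _⊓_; _≤_; z≤n; s≤s)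
open import Data.Nat.Properties using (<⇒≤)
open import Data.Product.Base using (_×_; _,_; ∃-syntax)
open import Data.Vec.Base as Vec using (Vec; _∷_; truncate; head; last; init; tail; toList)
open import Data.Vec.Relation.Unary.Linked using (Linked; [-]; _∷_)
open import Level using (0ℓ)
open import Relation.Binary.Core using (Rel)
open import Relation.Binary.PropositionalEquality.Core using (_≡_)
open import Relation.Nullary.Negation.Core using (¬_)

-- The finite sets AP and W are represented by Fin ∣AP∣ and Fin ∣W∣.
record FiniteKripkeStructure : Set₁ where
  field
    ∣AP∣ ∣W∣ : ℕ

  AP : Set
  AP = Fin ∣AP∣

  W : Set
  W = Fin ∣W∣

  field
    δ           : Rel W 0ℓ
    δ-leftTotal : ∀ w → ∃[ w′ ] δ w w′
    μ           : W → Subset ∣AP∣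
    w₀          : W

data Tree (A : Set) : Set where
  node : A → List (Tree A) → Tree A

-- The order in which a node lists its children is irrelevant.
data _≅_ {A : Set} : Rel (Tree A) 0ℓ where
  node : ∀ {a ts us} → Permutation _≅_ ts us → node a ts ≅ node a us

truncate-linked : ∀ {A : Set} {R : Rel A 0ℓ} {m n} (m≤n : m ≤ n) {xs : Vec A (suc n)} →
                  Linked R xs → Linked R (truncate (s≤s m≤n) xs)
truncate-linked z≤n       {_ ∷ _}     _        = [-]
truncate-linked (s≤s m≤n) {_ ∷ _ ∷ _} (r ∷ rs) = r ∷ truncate-linked m≤n rs

module _ (𝒦 : FiniteKripkeStructure) where
  open FiniteKripkeStructure 𝒦

  -- The track v₀ ⋯ vₙ has n = suc inner, so that n ≥ 1 and v₁, …, vₙ₋₁ are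
  -- its `inner` many internal positions.
  record Track : Set where
    constructor track
    field
      {inner} : ℕ
      states  : Vec W (2 + inner)
      linked  : Linked δ states

module _ {𝒦 : FiniteKripkeStructure} where
  open FiniteKripkeStructure 𝒦
  open Track

  length : Track 𝒦 → ℕ
  length ρ = 2 + inner ρ

  fst lst : Track 𝒦 → W
  fst ρ = head (states ρ)
  lst ρ = last (states ρ)

  intstates : Track 𝒦 → Subset ∣W∣
  intstates ρ = ⋃ (toList (Vec.map ⁅_⁆ (init (tail (states ρ)))))

  -- pref ρ j is ρ(0 , 1 + j); as j ranges over Fin (inner ρ), the index 1 + j
  -- ranges over 1, …, |ρ| - 2, so Pref(ρ) is the image of pref ρ.
  pref : (ρ : Track 𝒦) → Fin (inner ρ) → Track 𝒦
  pref ρ j = track (truncate (s≤s (s≤s j≤inner)) (states ρ))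
                   (truncate-linked (s≤s j≤inner) (linked ρ))
    where
    j≤inner : toℕ j ≤ inner ρ
    j≤inner = <⇒≤ (toℕ<n j)

  Label : Set
  Label = W × Subset ∣W∣ × W

  label : Track 𝒦 → Label
  label ρ = fst ρ , intstates ρ , lst ρ

  -- IsDescriptor k ρ t: the tree t is a representative of the B_k-descriptor
  -- of ρ, which the defining conditions determine up to _≅_.
  IsDescriptor : ℕ → Track 𝒦 → Tree Label → Set
  IsDescriptor zero    ρ (node a ts) = a ≡ label ρ × ts ≡ []
  IsDescriptor (suc k) ρ (node a ts) =
    a ≡ label ρ ×
    All (λ t → ∃[ j ] IsDescriptor k (pref ρ j) t) ts ×
    (∀ j → Any (IsDescriptor k (pref ρ j)) ts) ×
    AllPairs (λ t u → ¬ t ≅ u) ts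

  SameDescriptor : ℕ → Track 𝒦 → Track 𝒦 → Set
  SameDescriptor k ρ ρ′ =
    ∃[ t ] ∃[ t′ ] IsDescriptor k ρ t × IsDescriptor k ρ′ t′ × t ≅ t′

τ : ℕ → ℕ → ℕ
τ w k = (1 + (1 + w) ^ (2 * k + 4) + w) ⊓ (1 + (k + 3) ^ (w ^ 2 + 1) + w)

{-# OPTIONS --safe #-}
module Submission where

-- Whether two tracks from v₀ share their B_k-descriptor depends only on the
-- words v₁ ⋯ vₙ of their remaining states, through a relation ≈ at level
-- suc k: equal last letters, and proper prefixes matched at the level below.
-- A path whose word has d distinct letters is contracted at level suc r by
-- writing the word as y a z, where a is the last letter to occur for the first
-- time.  Then y has at most d - 1 letters and is contracted at level suc r,
-- which is sound since ≈ is a right congruence; z has only letters seen before,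
-- so that it suffices to contract it at level r.  The lengths obey Pascal's
-- rule, and the resulting binomial coefficient C(|W| + k + 2, |W|) is at most
-- both (1 + |W|) ^ (k + 2) and (k + 3) ^ |W|.

open import Defs
import Data.Bool.Properties as Bool
open import Data.Fin.Base using (Fin; zero; suc; toℕ)
open import Data.Fin.Properties as Fin using (all?; any?)
open import Data.Fin.Subset as Subset using (Subset; ⊤; ∣_∣; ⁅_⁆; ⋃; _-_)
import Data.Fin.Subset.Properties as Subset
open import Data.List.Base as List using (List; []; _∷_; _++_; allFin)
open import Data.List.Membership.DecPropositional using (_∈?_)
open import Data.List.Membership.Propositional using (_∈_; _∉_)
open import Data.List.Membership.Propositional.Properties
  using (∈-++⁺ˡ; ∈-++⁺ʳ; ∈-++⁻; ∈-allFin)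
open import Data.List.Properties using (length-++; ++-assoc)
open import Data.List.Relation.Binary.Permutation.Homogeneous
  using (Permutation; refl; prep; swap)
open import Data.List.Relation.Binary.Pointwise as Pointwise using (Pointwise; []; _∷_)
open import Data.List.Relation.Binary.Subset.Propositional using (_⊆_)
import Data.List.Relation.Binary.Subset.Propositional.Properties as ⊆
open import Data.List.Relation.Unary.All as All using (All; []; _∷_)
import Data.List.Relation.Unary.All.Properties as All
open import Data.List.Relation.Unary.AllPairs as AllPairs using (AllPairs; []; _∷_)
import Data.List.Relation.Unary.AllPairs.Properties as AllPairs
open import Data.List.Relation.Unary.Any as Any using (Any; here; there)
import Data.List.Relation.Unary.Any.Properties as Any
open import Data.Maybe.Base using (Maybe; just; nothing; _<∣>_)
open import Data.Maybe.Properties using (<∣>-assoc; <∣>-identityʳ; just-injective)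
open import Data.Nat.Base
  using (ℕ; zero; suc; _+_; _*_; _^_; _≤_; _<_; _>_; z≤n; s≤s; s≤s⁻¹; z<s;
         >-nonZero⁻¹; ≢-nonZero)
open import Data.Nat.Properties
open import Data.Product.Base using (_×_; _,_; ∃-syntax; Σ-syntax; proj₁; proj₂)
import Data.Product.Properties as Product
open import Data.Sum.Base using (_⊎_; inj₁; inj₂; [_,_]′)
open import Data.Vec.Base as Vec using (Vec; []; _∷_; toList; fromList; truncate)
import Data.Vec.Properties as Vec
open import Data.Vec.Relation.Unary.Linked using (Linked; [-]; _∷_)
open import Function.Base using (_∘_; id; flip)
open import Level using (0ℓ)
open import Relation.Binary.Core using (Rel)
open import Relation.Binary.Definitions
  using (Decidable; DecidableEquality; Reflexive; Symmetric; Transitive)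
open import Relation.Binary.PropositionalEquality
  using (_≡_; _≢_; refl; sym; trans; cong; cong₂; subst; subst₂; module ≡-Reasoning)
open import Relation.Nullary using (Dec; ¬_; yes; no; contradiction; _×-dec_)

-- Words, proper prefixes and the graded equivalence of words.

module _ {A : Set} where

  end : List A → Maybe A
  end []      = nothing
  end (a ∷ u) = end u <∣> just a

  end-++ : ∀ u z → end (u ++ z) ≡ (end z <∣> end u)
  end-++ []      z = sym (<∣>-identityʳ (end z))
  end-++ (a ∷ u) z rewrite end-++ u z = <∣>-assoc (end z) (end u) (just a)

  end≡nothing⇒[] : ∀ u → end u ≡ nothing → u ≡ []
  end≡nothing⇒[] []      _ = refl
  end≡nothing⇒[] (a ∷ u) e with end u
  end≡nothing⇒[] (a ∷ u) () | just _
  end≡nothing⇒[] (a ∷ u) () | nothing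

  infix 4 _◁_

  -- Proper prefixes, the empty one included. On the word of a track this gives one prefix more than
  -- Pref(ρ): `[]` stands for the single state v₀, which is not a track.
  data _◁_ : Rel (List A) 0ℓ where
    []  : ∀ {a u} → [] ◁ a ∷ u
    _∷_ : ∀ a {s u} → s ◁ u → a ∷ s ◁ a ∷ u

  ◁-++ʳ : ∀ {s u} z → s ◁ u → s ◁ u ++ z
  ◁-++ʳ z []        = []
  ◁-++ʳ z (a ∷ s◁u) = a ∷ ◁-++ʳ z s◁u

  ◁-++ˡ : ∀ p {s z} → s ◁ z → p ++ s ◁ p ++ z
  ◁-++ˡ []      s◁z = s◁z
  ◁-++ˡ (a ∷ p) s◁z = a ∷ ◁-++ˡ p s◁z

  -- The word `u` itself falls under the second alternative, with `t` empty.
  ◁-++⁻ : ∀ {s} u {z} → s ◁ u ++ z → s ◁ u ⊎ ∃[ t ] s ≡ u ++ t × t ◁ z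
  ◁-++⁻ []      s◁z = inj₂ (_ , refl , s◁z)
  ◁-++⁻ (a ∷ u) []  = inj₁ []
  ◁-++⁻ (a ∷ u) (a ∷ s◁) with ◁-++⁻ u s◁
  ... | inj₁ s◁u              = inj₁ (a ∷ s◁u)
  ... | inj₂ (t , refl , t◁z) = inj₂ (t , refl , t◁z)

  Simulates : Rel (List A) 0ℓ → Rel (List A) 0ℓ
  Simulates R u u′ = ∀ {s} → s ◁ u → ∃[ s′ ] s′ ◁ u′ × R s s′

  infix 4 _≈[_]_

  -- For the word v₁ ⋯ vₙ of a track v₀ v₁ ⋯ vₙ, level suc k corresponds to the
  -- B_k-descriptor; the empty proper prefix only matches itself.
  _≈[_]_ : List A → ℕ → List A → Set
  u ≈[ zero ]  u′ = end u ≡ end u′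
  u ≈[ suc m ] u′ = end u ≡ end u′ × Simulates _≈[ m ]_ u u′ × Simulates _≈[ m ]_ u′ u

  ≈⇒end≡ : ∀ m {u u′} → u ≈[ m ] u′ → end u ≡ end u′
  ≈⇒end≡ zero    e       = e
  ≈⇒end≡ (suc m) (e , _) = e

  ∷≉[] : ∀ m a u → ¬ a ∷ u ≈[ m ] []
  ∷≉[] m a u a∷u≈[] = contradiction (end≡nothing⇒[] (a ∷ u) (≈⇒end≡ m a∷u≈[])) λ ()

  ≈-refl : ∀ m → Reflexive _≈[ m ]_
  ≈-refl zero    = refl
  ≈-refl (suc m) = refl , (λ s◁u → _ , s◁u , ≈-refl m) , (λ s◁u → _ , s◁u , ≈-refl m)

  ≈-sym : ∀ m → Symmetric _≈[ m ]_
  ≈-sym zero    e               = sym e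
  ≈-sym (suc m) (e , to , from) = sym e , from , to

  ≈-trans : ∀ m → Transitive _≈[ m ]_
  ≈-trans zero    = trans
  ≈-trans (suc m) {u} {u′} {u″} (e , to , from) (e′ , to′ , from′) =
    trans e e′ , ∘-simulates to to′ , ∘-simulates from′ from
    where
    ∘-simulates : ∀ {x y z} → Simulates _≈[ m ]_ x y → Simulates _≈[ m ]_ y z →
                  Simulates _≈[ m ]_ x z
    ∘-simulates f g s◁x =
      let _ , s′◁y , s≈s′ = f s◁x ; _ , s″◁z , s′≈s″ = g s′◁y
      in  _ , s″◁z , ≈-trans m s≈s′ s′≈s″

  ≈-pred : ∀ m {u u′} → u ≈[ suc m ] u′ → u ≈[ m ] u′
  ≈-pred zero    (e , _)         = e
  ≈-pred (suc m) (e , to , from) = e , weaken to , weaken from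
    where
    weaken : ∀ {x y} → Simulates _≈[ suc m ]_ x y → Simulates _≈[ m ]_ x y
    weaken f s◁x = let _ , s′◁y , s≈s′ = f s◁x in _ , s′◁y , ≈-pred m s≈s′

  -- A prefix ending strictly inside `u` is matched by hypothesis. One of the form `u ++ t` is
  -- matched by `u′ ++ t` with the same `t`, by induction one level down.
  ≈-++ʳ : ∀ m {u u′} z → u ≈[ m ] u′ → u ++ z ≈[ m ] u′ ++ z
  ≈-++ʳ zero {u} {u′} z e rewrite end-++ u z | end-++ u′ z = cong (end z <∣>_) e
  ≈-++ʳ (suc m) {u} {u′} z u≈u′ =
    ≈-++ʳ zero {u} {u′} z (proj₁ u≈u′) , step u≈u′ , step (≈-sym (suc m) u≈u′)
    where
    step : ∀ {x y} → x ≈[ suc m ] y → Simulates _≈[ m ]_ (x ++ z) (y ++ z)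
    step {x} {y} x≈y@(_ , to , _) s◁ with ◁-++⁻ x s◁
    ... | inj₁ s◁x = let _ , s′◁y , s≈s′ = to s◁x in _ , ◁-++ʳ z s′◁y , s≈s′
    ... | inj₂ (t , refl , t◁z) = _ , ◁-++ˡ y t◁z , ≈-++ʳ m t (≈-pred m x≈y)

  -- The condition `z ≢ []` serves the case where `e` occurs only at the very end of `p`: then `p`
  -- as a whole must still be a proper prefix.
  prefix-ending : ∀ p {e z} → e ∈ p → z ≢ [] → ∃[ s ] s ◁ p ++ z × end s ≡ just e
  prefix-ending (e ∷ [])    {z = []}    (here refl) z≢[] = contradiction refl z≢[]
  prefix-ending (e ∷ [])    {z = _ ∷ _} (here refl) _    = e ∷ [] , (e ∷ []) , refl
  prefix-ending (e ∷ _ ∷ _) (here refl) _                = e ∷ [] , (e ∷ []) , refl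
  prefix-ending (a ∷ p)     (there e∈p) z≢[]             =
    let s , s◁ , e≡ = prefix-ending p e∈p z≢[]
    in  a ∷ s , a ∷ s◁ , cong (_<∣> just a) e≡

  end-∈ : ∀ u {e} → end u ≡ just e → e ∈ u
  end-∈ (a ∷ u) eq with end u in eq′
  end-∈ (a ∷ u) refl | just _  = there (end-∈ u eq′)
  end-∈ (a ∷ u) refl | nothing = here refl

  ◁⇒⊆ : ∀ {s u : List A} → s ◁ u → s ⊆ u
  ◁⇒⊆ (a ∷ s◁u) (here e)  = here e
  ◁⇒⊆ (a ∷ s◁u) (there i) = there (◁⇒⊆ s◁u i)

  -- After p, the letters of z and z′ add nothing to the set of letters seen so
  -- far, so one more level of prefixes can be matched.
  ≈-++ˡ : ∀ m p {z z′} → z ⊆ p → z′ ⊆ p → z ≈[ m ] z′ → p ++ z ≈[ suc m ] p ++ z′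
  ≈-++ˡ m p {z} {z′} z⊆p z′⊆p z≈z′ =
    end≡ (≈⇒end≡ m z≈z′) , step m z⊆p z′⊆p z≈z′ , step m z′⊆p z⊆p (≈-sym m z≈z′)
    where
    end≡ : ∀ {x y} → end x ≡ end y → end (p ++ x) ≡ end (p ++ y)
    end≡ {x} {y} e rewrite end-++ p x | end-++ p y = cong (_<∣> end p) e

    step : ∀ m {x y} → x ⊆ p → y ⊆ p → x ≈[ m ] y → Simulates _≈[ m ]_ (p ++ x) (p ++ y)
    step m {x} {y} x⊆p y⊆p x≈y s◁ with ◁-++⁻ p s◁
    ... | inj₁ s◁p = _ , ◁-++ʳ y s◁p , ≈-refl m
    -- At level 0 the hypothesis compares only last letters, but this already forces `x` to be empty
    -- along with `y`.
    step zero {x} {[]} x⊆p y⊆p x≈y s◁ | inj₂ (t , refl , t◁x) with refl ← end≡nothing⇒[] x x≈y =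
      contradiction t◁x λ ()
    step zero {_} {_ ∷ _} x⊆p y⊆p x≈y s◁ | inj₂ (t , refl , t◁x) with end t in end-t
    ... | nothing rewrite end≡nothing⇒[] t end-t = _ , ◁-++ˡ p [] , refl
    -- Level 0 asks for a prefix with the same last letter only, and that letter, occurring in `p`,
    -- already ends some prefix.
    ... | just e  =
      let s , s◁ , end-s = prefix-ending p (x⊆p (◁⇒⊆ t◁x (end-∈ t end-t))) λ ()
      in  s , s◁ , (begin
            end (p ++ t)        ≡⟨ end-++ p t ⟩
            (end t <∣> end p)   ≡⟨ cong (_<∣> end p) end-t ⟩
            just e              ≡⟨ end-s ⟨
            end s               ∎)
      where open ≡-Reasoning
    -- `t` and `t′` agree one level lower than required; the recursive call regains that level, as
    -- both use only letters of `p`.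
    step (suc m) x⊆p y⊆p (_ , to , _) s◁ | inj₂ (t , refl , t◁x) =
      let t′ , t′◁y , t≈t′ = to t◁x
      in  _ , ◁-++ˡ p t′◁y ,
          ≈-++ˡ m p (x⊆p ∘ ◁⇒⊆ t◁x) (y⊆p ∘ ◁⇒⊆ t′◁y) t≈t′

-- The length bound and its comparison with τ.

-- bound r d is the binomial coefficient C(d + r + 1, d).
bound : ℕ → ℕ → ℕ
bound r       zero    = 1
bound zero    (suc d) = 1 + bound zero d
bound (suc r) (suc d) = bound (suc r) d + bound r (suc d)

bound>0 : ∀ r d → 0 < bound r d
bound>0 r       zero    = ≤-refl
bound>0 zero    (suc d) = z<s
bound>0 (suc r) (suc d) = <-≤-trans (bound>0 (suc r) d) (m≤m+n _ _)

-- In Pascal's rule the two summands are at most 1 + d times and once (2 + d) ^ (1 + r).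
bound≤[1+d]^[1+r] : ∀ r d → bound r d ≤ (1 + d) ^ (1 + r)
bound≤[1+d]^[1+r] r zero = ≤-reflexive (sym (^-zeroˡ (1 + r)))
bound≤[1+d]^[1+r] zero (suc d) = s≤s (bound≤[1+d]^[1+r] zero d)
bound≤[1+d]^[1+r] (suc r) (suc d) = begin
  bound (suc r) d + bound r (suc d)
    ≤⟨ +-mono-≤ (bound≤[1+d]^[1+r] (suc r) d) (bound≤[1+d]^[1+r] r (suc d)) ⟩
  (1 + d) * (1 + d) ^ (1 + r) + (2 + d) ^ (1 + r)
    ≤⟨ +-monoˡ-≤ _ (*-monoʳ-≤ (1 + d) (^-monoˡ-≤ (1 + r) (n≤1+n (1 + d)))) ⟩
  (1 + d) * (2 + d) ^ (1 + r) + (2 + d) ^ (1 + r)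
    ≡⟨ +-comm _ ((2 + d) ^ (1 + r)) ⟩
  (2 + d) ^ (2 + r) ∎
  where open ≤-Reasoning

-- Here the two summands of Pascal's rule are at most once and 2 + r times (3 + r) ^ d.
bound≤[2+r]^d : ∀ r d → bound r d ≤ (2 + r) ^ d
bound≤[2+r]^d r zero = ≤-refl
bound≤[2+r]^d zero (suc d) = begin
  1 + bound zero d   ≤⟨ +-mono-≤ (>-nonZero⁻¹ _ {{m^n≢0 2 d}}) (bound≤[2+r]^d zero d) ⟩
  2 ^ d + 2 ^ d      ≡⟨ cong (2 ^ d +_) (+-identityʳ (2 ^ d)) ⟨
  2 ^ suc d          ∎
  where open ≤-Reasoning
bound≤[2+r]^d (suc r) (suc d) = begin
  bound (suc r) d + bound r (suc d)
    ≤⟨ +-mono-≤ (bound≤[2+r]^d (suc r) d) (bound≤[2+r]^d r (suc d)) ⟩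
  (3 + r) ^ d + (2 + r) * (2 + r) ^ d
    ≤⟨ +-monoʳ-≤ ((3 + r) ^ d) (*-monoʳ-≤ (2 + r) (^-monoˡ-≤ d (n≤1+n (2 + r)))) ⟩
  (3 + r) ^ suc d ∎
  where open ≤-Reasoning

-- The first argument is `suc k` because B_k-descriptors correspond to level `suc k` of `≈`.
bound≤τ : ∀ w k → bound (suc k) w ≤ τ w k
bound≤τ w k = ⊓-glb
  (begin
    bound (suc k) w                  ≤⟨ bound≤[1+d]^[1+r] (suc k) w ⟩
    (1 + w) ^ (2 + k)                ≤⟨ ^-monoʳ-≤ (1 + w) 2+k≤2k+4 ⟩
    (1 + w) ^ (2 * k + 4)            ≤⟨ n≤1+n _ ⟩
    1 + (1 + w) ^ (2 * k + 4)        ≤⟨ m≤m+n _ w ⟩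
    1 + (1 + w) ^ (2 * k + 4) + w    ∎)
  (begin
    bound (suc k) w                  ≤⟨ bound≤[2+r]^d (suc k) w ⟩
    (3 + k) ^ w                      ≡⟨ cong (_^ w) (+-comm 3 k) ⟩
    (k + 3) ^ w                      ≤⟨ ^-monoʳ-≤ (k + 3) {{≢-nonZero (m+1+n≢0 k)}} (w≤w²+1 w) ⟩
    (k + 3) ^ (w ^ 2 + 1)            ≤⟨ n≤1+n _ ⟩
    1 + (k + 3) ^ (w ^ 2 + 1)        ≤⟨ m≤m+n _ w ⟩
    1 + (k + 3) ^ (w ^ 2 + 1) + w    ∎)
  where
  open ≤-Reasoning

  2+k≤2k+4 : 2 + k ≤ 2 * k + 4
  2+k≤2k+4 = begin
    2 + k      ≡⟨ +-comm 2 k ⟩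
    k + 2      ≤⟨ +-mono-≤ (m≤m+n k (k + 0)) (s≤s (s≤s z≤n)) ⟩
    2 * k + 4  ∎

  w≤w²+1 : ∀ w → w ≤ w ^ 2 + 1
  w≤w²+1 zero    = z≤n
  w≤w²+1 (suc w) = begin
    suc w                ≤⟨ m≤m*n (suc w) (suc w) ⟩
    suc w * suc w        ≡⟨ cong (suc w *_) (*-identityʳ (suc w)) ⟨
    suc w ^ 2            ≤⟨ m≤m+n _ 1 ⟩
    suc w ^ 2 + 1        ∎

-- Paths, whose words omit the starting state, and occurrences of letters.

data Path {A : Set} (R : Rel A 0ℓ) : A → List A → A → Set where
  []  : ∀ {v} → Path R v [] v
  _∷_ : ∀ {v a x w} → R v a → Path R a x w → Path R v (a ∷ x) w

module _ {A : Set} {R : Rel A 0ℓ} where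

  Path-++⁺ : ∀ {v u a w} y {z} → Path R v y u → R u a → Path R a z w → Path R v (y ++ a ∷ z) w
  Path-++⁺ []      []      r π′ = r ∷ π′
  Path-++⁺ (b ∷ y) (s ∷ π) r π′ = s ∷ Path-++⁺ y π r π′

  Path-++⁻ : ∀ {v a w} y {z} → Path R v (y ++ a ∷ z) w →
             ∃[ u ] Path R v y u × R u a × Path R a z w
  Path-++⁻ []      (r ∷ π) = _ , [] , r , π
  Path-++⁻ (b ∷ y) (s ∷ π) = let u , π₁ , r , π₂ = Path-++⁻ y π in u , s ∷ π₁ , r , π₂

  end-Path : ∀ {a x w} → Path R a x w → end (a ∷ x) ≡ just w
  end-Path     []      = refl
  end-Path {a} (r ∷ π) = cong (_<∣> just a) (end-Path π)

module _ {A : Set} (_≟_ : DecidableEquality A) where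

  first-occurrence : ∀ {e : A} {x} → e ∈ x → ∃[ y ] ∃[ z ] x ≡ y ++ e ∷ z × e ∉ y
  first-occurrence {e} {a ∷ x} e∈ with e ≟ a
  ... | yes refl = [] , x , refl , λ ()
  ... | no e≢a with e∈
  ...   | here e≡a  = contradiction e≡a e≢a
  ...   | there e∈x =
    let y , z , eq , e∉y = first-occurrence e∈x
    in  a ∷ y , z , cong (a ∷_) eq , λ { (here e≡a) → e≢a e≡a ; (there e∈y) → e∉y e∈y }

  -- `c` collects the letters read so far. The rest of the word is searched first, with the current
  -- letter `b` added to `c`; only if nothing new follows can `b` be the answer, and it is when it
  -- is missing from `c`.
  last-new-letter : ∀ c (x : List A) → x ⊆ c ⊎
    ∃[ y ] ∃[ a ] ∃[ z ] x ≡ y ++ a ∷ z × a ∉ c × a ∉ y × z ⊆ c ++ y ++ a ∷ []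
  last-new-letter c []      = inj₁ λ ()
  last-new-letter c (b ∷ x) with last-new-letter (c ++ b ∷ []) x
  ... | inj₂ (y , a , z , x≡ , a∉cb , a∉y , z⊆) =
    inj₂ (b ∷ y , a , z , cong (b ∷_) x≡ , a∉cb ∘ ∈-++⁺ˡ ,
          (λ { (here refl) → a∉cb (∈-++⁺ʳ c (here refl)) ; (there a∈y) → a∉y a∈y }) ,
          subst (_ ∈_) (++-assoc c (b ∷ []) (y ++ a ∷ [])) ∘ z⊆)
  ... | inj₁ x⊆cb with _∈?_ _≟_ b c
  ...   | no b∉c  = inj₂ ([] , b , x , refl , b∉c , (λ ()) , x⊆cb)
  ...   | yes b∈c = inj₁ λ
    { (here refl) → b∈c
    ; (there i)   → [ id , (λ { (here refl) → b∈c }) ]′ (∈-++⁻ c (x⊆cb i)) }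

-- Contraction of paths.

module _ {n : ℕ} {R : Rel (Fin n) 0ℓ} where

  -- `short` is strict so that `b` bounds the number of states, the start included; such bounds add
  -- up when two paths are joined by an edge. `letters` keeps a contracted tail among the letters
  -- seen before it, as `≈-++ˡ` requires.
  record Contraction (r b : ℕ) (v : Fin n) (x : List (Fin n)) (w : Fin n) : Set where
    constructor contraction
    field
      {word}    : List (Fin n)
      short     : List.length word < b
      letters   : word ⊆ x
      same-desc : x ≈[ r ] word
      path      : Path R v word w

  open Contraction

  erase : ∀ {b v y u w z} → Contraction zero b v y u → R u w → Path R w z w →
          Contraction zero (1 + b) v (y ++ w ∷ z) w
  erase {y = y} {w = w} {z} c r π = record
    { word      = word c ++ w ∷ []
    ; short     = s≤s (≤-trans (≤-reflexive length≡) (short c))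
    ; letters   = ⊆.++⁺ (letters c) (⊆.∷⁺ʳ w λ ())
    ; same-desc = end≡
    ; path      = Path-++⁺ _ (path c) r []
    }
    where
    length≡ : List.length (word c ++ w ∷ []) ≡ suc (List.length (word c))
    length≡ = trans (length-++ (word c)) (+-comm _ 1)

    end≡ : end (y ++ w ∷ z) ≡ end (word c ++ w ∷ [])
    end≡ rewrite end-++ y (w ∷ z) | end-++ (word c) (w ∷ []) | end-Path π = refl

  splice : ∀ {r b b′ v y u a z w} → Contraction (suc r) b v y u → R u a → Contraction r b′ a z w →
           z ⊆ y ++ a ∷ [] → Contraction (suc r) (b + b′) v (y ++ a ∷ z) w
  splice {r} {y = y} {a = a} {z} c s c′ z⊆ya = record
    { word      = word c ++ a ∷ word c′
    ; short     = ≤-trans (s≤s (≤-reflexive (length-++ (word c)))) (+-mono-≤ (short c) (short c′))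
    ; letters   = ⊆.++⁺ (letters c) (⊆.∷⁺ʳ a (letters c′))
    -- The tail is replaced first, while the original `y` still precedes it, since `z⊆ya` speaks of
    -- that `y`; the head is then replaced by right congruence.
    ; same-desc = ≈-trans (suc r)
        (subst₂ _≈[ suc r ]_ (++-assoc y (a ∷ []) z) (++-assoc y (a ∷ []) (word c′))
          (≈-++ˡ r (y ++ a ∷ []) z⊆ya (z⊆ya ∘ letters c′) (same-desc c′)))
        (≈-++ʳ (suc r) (a ∷ word c′) (same-desc c))
    ; path      = Path-++⁺ _ (path c) s (path c′)
    }

  ∣p-a∣≤d : ∀ {d} {p : Subset n} {a} → ∣ p ∣ ≤ suc d → a Subset.∈ p → ∣ p - a ∣ ≤ d
  ∣p-a∣≤d ∣p∣≤1+d a∈p = s≤s⁻¹ (≤-trans (Subset.x∈p⇒∣p-x∣<∣p∣ a∈p) ∣p∣≤1+d)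

  y⊆p-a : ∀ {p : Subset n} {y a z} → (∀ {e} → e ∈ y ++ a ∷ z → e Subset.∈ p) → a ∉ y →
          ∀ {e} → e ∈ y → e Subset.∈ p - a
  y⊆p-a x⊆p a∉y e∈y = Subset.x∈p∧x≢y⇒x∈p-y (x⊆p (∈-++⁺ˡ e∈y)) λ { refl → a∉y e∈y }

  -- At level 0 the path is cut at the first visit of its last state w, which
  -- frees the part before it from w.
  contract : ∀ r d (p : Subset n) {v x w} → ∣ p ∣ ≤ d → (∀ {e} → e ∈ x → e Subset.∈ p) →
             Path R v x w → Contraction r (bound r d) v x w
  contract r d p {x = []} _ _ π = contraction (bound>0 r d) id (≈-refl r) π
  contract r zero p {x = a ∷ x} ∣p∣≤0 x⊆p π =
    contradiction (<-≤-trans (Subset.x∈p⇒∣p-x∣<∣p∣ (x⊆p (here refl))) ∣p∣≤0) λ ()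
  contract zero (suc d) p {v} {x@(_ ∷ _)} {w} ∣p∣≤1+d x⊆p π@(_ ∷ π₁) =
    let w∈x               = end-∈ x (end-Path π₁)
        y , z , x≡ , w∉y  = first-occurrence Fin._≟_ w∈x
        _ , πy , r , πz   = Path-++⁻ y (subst (λ x → Path R v x w) x≡ π)
        y⊆p-w             = y⊆p-a (x⊆p ∘ subst (_ ∈_) (sym x≡)) w∉y
        cy                = contract zero d (p - w) (∣p-a∣≤d ∣p∣≤1+d (x⊆p w∈x)) y⊆p-w πy
    in  subst (λ x → Contraction zero _ v x w) (sym x≡) (erase cy r πz)
  contract (suc r) (suc d) p {v} {x@(_ ∷ _)} {w} ∣p∣≤1+d x⊆p π with last-new-letter Fin._≟_ [] x
  ... | inj₁ x⊆[] = contradiction (x⊆[] (here refl)) λ ()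
  ... | inj₂ (y , a , z , x≡ , _ , a∉y , z⊆ya) =
    let x⊆p′              = λ {e} → x⊆p {e} ∘ subst (_ ∈_) (sym x≡)
        _ , πy , s , πz   = Path-++⁻ y (subst (λ x → Path R v x w) x≡ π)
        a∈p               = x⊆p′ (∈-++⁺ʳ y (here refl))
        -- `y` avoids `a`, so its letter budget drops; `z` may use all of `p`, so the level drops
        -- instead.
        cy                = contract (suc r) d (p - a) (∣p-a∣≤d ∣p∣≤1+d a∈p) (y⊆p-a x⊆p′ a∉y) πy
        cz                = contract r (suc d) p ∣p∣≤1+d (x⊆p′ ∘ ∈-++⁺ʳ y ∘ there) πz
    in  subst (λ x → Contraction (suc r) _ v x w) (sym x≡) (splice cy s cz z⊆ya)

-- Tree isomorphism and choice of representatives.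

≅-refl : ∀ {A : Set} (t : Tree A) → t ≅ t
≅-refl {A} (node a ts) = node (refl (pointwise ts))
  where
  pointwise : ∀ us → Pointwise _≅_ us us
  pointwise []       = []
  pointwise (u ∷ us) = ≅-refl u ∷ pointwise us

≅-trans : ∀ {A : Set} {t u v : Tree A} → t ≅ u → u ≅ v → t ≅ v
≅-trans (node p) (node q) = node (Permutation.trans p q)

-- Reversing the relation together with the lists lets `Permutation-Any` transport children in both
-- directions of an isomorphism.
Permutation-flip : ∀ {A : Set} {R : Rel A 0ℓ} {xs ys} →
                   Permutation R xs ys → Permutation (flip R) ys xs
Permutation-flip (refl rs)      = refl (Pointwise.symmetric id rs)
Permutation-flip (prep r p)     = prep r (Permutation-flip p)
Permutation-flip (swap r₁ r₂ p) = swap r₂ r₁ (Permutation-flip p)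
Permutation-flip (Permutation.trans p q) =
  Permutation.trans (Permutation-flip q) (Permutation-flip p)

module _ {A : Set} {R : Rel A 0ℓ} (R-trans : Transitive R) where

  Permutation-Any : ∀ {P : A → Set} {xs ys} → Permutation R xs ys → Any P xs →
                    Any (λ y → ∃[ x ] P x × R x y) ys
  Permutation-Any (refl (r ∷ rs)) (here px) = here (_ , px , r)
  Permutation-Any (refl (r ∷ rs)) (there i) = there (Permutation-Any (refl rs) i)
  Permutation-Any (prep r p)      (here px) = here (_ , px , r)
  Permutation-Any (prep r p)      (there i) = there (Permutation-Any p i)
  Permutation-Any (swap r₁ r₂ p)  (here px) = there (here (_ , px , r₁))
  Permutation-Any (swap r₁ r₂ p)  (there (here px)) = here (_ , px , r₂)
  Permutation-Any (swap r₁ r₂ p)  (there (there i)) = there (there (Permutation-Any p i))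
  Permutation-Any (Permutation.trans p q) i         =
    Any.map (λ (_ , (_ , px , r) , r′) → _ , px , R-trans r r′)
            (Permutation-Any q (Permutation-Any p i))

module _ {I : Set} {_~_ : Rel I 0ℓ} (~-refl : Reflexive _~_) (_~?_ : Decidable _~_) where

  -- A greedy choice from the right. Applied to prefixes, it yields one child per class, hence no
  -- isomorphic siblings.
  representatives : (is : List I) →
    ∃[ js ] All (λ i → Any (i ~_) js) is × AllPairs (λ i j → ¬ i ~ j) js
  representatives []       = [] , [] , []
  representatives (i ∷ is) with js , covered , distinct ← representatives is | Any.any? (i ~?_) js
  ... | yes i~js = js , i~js ∷ covered , distinct
  ... | no  i≁js = i ∷ js , here ~-refl ∷ All.map there covered , All.¬Any⇒All¬ js i≁js ∷ distinct

-- Prefixes and internal states of vectors.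

truncate-◁ : ∀ {A : Set} {n} (xs : Vec A (suc n)) (j : Fin n) (j≤n : toℕ j ≤ n) →
             toList (truncate (s≤s j≤n) xs) ◁ toList xs
truncate-◁ (x ∷ y ∷ xs) zero    z≤n       = x ∷ []
truncate-◁ (x ∷ xs)     (suc j) (s≤s j≤n) = x ∷ truncate-◁ xs j j≤n

-- Quantifying over the proof of `toℕ j ≤ n` makes the equation apply to the proof built into
-- `pref`.
◁-truncate : ∀ {A : Set} {n} (xs : Vec A n) {s} → s ◁ toList xs →
             Σ[ j ∈ Fin n ] ∀ (j≤n : toℕ j ≤ n) → s ≡ toList (truncate j≤n xs)
◁-truncate (x ∷ xs) []        = zero , λ { z≤n → refl }
◁-truncate (x ∷ xs) (_ ∷ s◁) =
  let j , s≡ = ◁-truncate xs s◁ in suc j , λ { (s≤s j≤n) → cong (x ∷_) (s≡ j≤n) }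

module _ {n : ℕ} where

  -- An internal state is the last letter of the proper prefix that stops there. In this way `≈`
  -- determines `intstates`.
  ∈-⋃-init⁻ : ∀ {m i} (vs : Vec (Fin n) (suc m)) →
              i Subset.∈ ⋃ (toList (Vec.map ⁅_⁆ (Vec.init vs))) →
              ∃[ s ] s ◁ toList vs × end s ≡ just i
  ∈-⋃-init⁻ (v ∷ [])     i∈ = contradiction i∈ Subset.∉⊥
  ∈-⋃-init⁻ (v ∷ w ∷ vs) i∈ with Subset.x∈p∪q⁻ ⁅ v ⁆ _ i∈
  ... | inj₁ i∈v with refl ← Subset.x∈⁅y⁆⇒x≡y v i∈v = v ∷ [] , (v ∷ []) , refl
  ... | inj₂ i∈′ =
    let s , s◁ , end-s = ∈-⋃-init⁻ (w ∷ vs) i∈′ in v ∷ s , v ∷ s◁ , cong (_<∣> just v) end-s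

  ∈-⋃-init⁺ : ∀ {m i s} (vs : Vec (Fin n) (suc m)) → s ◁ toList vs → end s ≡ just i →
              i Subset.∈ ⋃ (toList (Vec.map ⁅_⁆ (Vec.init vs)))
  ∈-⋃-init⁺ (v ∷ w ∷ vs) (_∷_ _ {s} s◁) end-s with end s in end-s′
  ∈-⋃-init⁺ (v ∷ w ∷ vs) (v ∷ s◁) refl | just _  =
    Subset.x∈p∪q⁺ (inj₂ (∈-⋃-init⁺ (w ∷ vs) s◁ end-s′))
  ∈-⋃-init⁺ (v ∷ w ∷ vs) (v ∷ s◁) refl | nothing =
    Subset.x∈p∪q⁺ (inj₁ (Subset.x∈⁅x⁆ v))

  end-last : ∀ {m} (vs : Vec (Fin n) (suc m)) → end (toList vs) ≡ just (Vec.last vs)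
  end-last (v ∷ [])     = refl
  end-last (v ∷ w ∷ vs) = cong (_<∣> just v) (end-last (w ∷ vs))

-- Existence and comparison of descriptors.

module _ {𝒦 : FiniteKripkeStructure} where
  open FiniteKripkeStructure 𝒦
  open Track

  infix 4 _∼[_]_

  -- Equality of B_k-descriptors phrased on tracks, as a back-and-forth condition. It is decidable,
  -- which the choice of children in `descriptor` relies on.
  _∼[_]_ : Track 𝒦 → ℕ → Track 𝒦 → Set
  ρ ∼[ zero ]  ρ′ = label {𝒦} ρ ≡ label ρ′
  ρ ∼[ suc k ] ρ′ = label ρ ≡ label ρ′ ×
    (∀ j → ∃[ j′ ] pref ρ j ∼[ k ] pref ρ′ j′) ×
    (∀ j′ → ∃[ j ] pref ρ j ∼[ k ] pref ρ′ j′)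

  _≟ᴸ_ : DecidableEquality (Label {𝒦})
  _≟ᴸ_ = Product.≡-dec Fin._≟_ (Product.≡-dec (Vec.≡-dec Bool._≟_) Fin._≟_)

  _∼?[_]_ : ∀ ρ k ρ′ → Dec (ρ ∼[ k ] ρ′)
  ρ ∼?[ zero ]  ρ′ = label ρ ≟ᴸ label ρ′
  ρ ∼?[ suc k ] ρ′ = label ρ ≟ᴸ label ρ′ ×-dec
    all? (λ j → any? λ j′ → pref ρ j ∼?[ k ] pref ρ′ j′) ×-dec
    all? (λ j′ → any? λ j → pref ρ j ∼?[ k ] pref ρ′ j′)

  ∼-refl : ∀ k {ρ} → ρ ∼[ k ] ρ
  ∼-refl zero    = refl
  ∼-refl (suc k) = refl , (λ j → j , ∼-refl k) , (λ j → j , ∼-refl k)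

  ∼-sym : ∀ k {ρ ρ′} → ρ ∼[ k ] ρ′ → ρ′ ∼[ k ] ρ
  ∼-sym zero    l≡               = sym l≡
  ∼-sym (suc k) (l≡ , to , from) =
    sym l≡ ,
    (λ j → let j′ , r = from j in j′ , ∼-sym k r) ,
    (λ j → let j′ , r = to j in j′ , ∼-sym k r)

  -- The very same tree serves both tracks: each child changes only the prefix it is attributed to,
  -- and distinctness concerns the tree alone.
  IsDescriptor-resp-∼ : ∀ k {ρ ρ′ t} → ρ ∼[ k ] ρ′ → IsDescriptor k ρ t → IsDescriptor k ρ′ t
  IsDescriptor-resp-∼ zero    {t = node _ _} ρ∼ρ′ (a≡ , ts≡) = trans a≡ ρ∼ρ′ , ts≡
  IsDescriptor-resp-∼ (suc k) {t = node _ _} (l≡ , to , from) (a≡ , sound , complete , distinct) =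
    trans a≡ l≡ ,
    All.map (λ (j , d) → let j′ , j∼j′ = to j in j′ , IsDescriptor-resp-∼ k j∼j′ d) sound ,
    (λ j′ → let j , j∼j′ = from j′ in Any.map (IsDescriptor-resp-∼ k j∼j′) (complete j)) ,
    distinct

  -- A prefix of `ρ` is described by some child of `t`; the isomorphism carries that child to one of
  -- `t′`, which describes a prefix of `ρ′`, and induction relates the two prefixes.
  IsDescriptor-unique : ∀ k {ρ ρ′ t t′} → IsDescriptor k ρ t → IsDescriptor k ρ′ t′ →
                        t ≅ t′ → ρ ∼[ k ] ρ′
  IsDescriptor-unique zero    {t = node _ _} {node _ _} (a≡ , _) (b≡ , _) (node _) =
    trans (sym a≡) b≡
  IsDescriptor-unique (suc k) {t = node _ _} {node _ _}
    (a≡ , sound , complete , _) (b≡ , sound′ , complete′ , _) (node p) =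
    trans (sym a≡) b≡ ,
    (λ j → let (j′ , d′) , _ , d , t≅t′ =
                 All.lookupAny sound′ (Permutation-Any ≅-trans p (complete j))
           in  j′ , IsDescriptor-unique k d d′ t≅t′) ,
    (λ j′ → let (j , d) , _ , d′ , t≅t′ =
                  All.lookupAny sound
                    (Permutation-Any (flip ≅-trans) (Permutation-flip p) (complete′ j′))
            in  j , IsDescriptor-unique k d d′ t≅t′)

  descriptor : ∀ k (ρ : Track 𝒦) → Σ[ t ∈ Tree (Label {𝒦}) ] IsDescriptor k ρ t
  descriptor zero    ρ = node (label ρ) [] , refl , refl
  descriptor (suc k) ρ =
    let js , covered , distinct = representatives (∼-refl k) (λ i j → pref ρ i ∼?[ k ] pref ρ j)
                                                  (allFin (inner ρ))
    in  node (label ρ) (List.map tree js) , refl ,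
        All.map⁺ (All.universal (λ j → j , isDescriptor j) js) ,
        (λ j → Any.map⁺ (Any.map (λ j∼j′ → IsDescriptor-resp-∼ k (∼-sym k j∼j′) (isDescriptor _))
                                 (All.lookup covered (∈-allFin j)))) ,
        -- Isomorphic siblings would, by `IsDescriptor-unique`, come from related prefixes.
        AllPairs.map⁺ (AllPairs.map
          (λ i≁j t≅u → i≁j (IsDescriptor-unique k (isDescriptor _) (isDescriptor _) t≅u))
          distinct)
    where
    tree : Fin (inner ρ) → Tree (Label {𝒦})
    tree j = proj₁ (descriptor k (pref ρ j))

    isDescriptor : ∀ j → IsDescriptor k (pref ρ j) (tree j)
    isDescriptor j = proj₂ (descriptor k (pref ρ j))

  ∼⇒SameDescriptor : ∀ k {ρ ρ′} → ρ ∼[ k ] ρ′ → SameDescriptor k ρ ρ′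
  ∼⇒SameDescriptor k {ρ} ρ∼ρ′ =
    let t , d = descriptor k ρ in t , t , d , IsDescriptor-resp-∼ k ρ∼ρ′ d , ≅-refl t

  -- From words back to tracks.

  word : Track 𝒦 → List W
  word ρ = toList (Vec.tail (states ρ))

  intstates-⊆ : ∀ m {ρ ρ′ : Track 𝒦} → Simulates _≈[ m ]_ (word ρ) (word ρ′) →
                intstates ρ Subset.⊆ intstates ρ′
  intstates-⊆ m {track (_ ∷ vs) _} {track (_ ∷ vs′) _} f i∈ =
    let s , s◁ , end-s = ∈-⋃-init⁻ vs i∈ ; s′ , s′◁ , s≈s′ = f s◁
    in  ∈-⋃-init⁺ vs′ s′◁ (trans (sym (≈⇒end≡ m s≈s′)) end-s)

  lst-cong : ∀ {ρ ρ′ : Track 𝒦} → end (word ρ) ≡ end (word ρ′) → lst ρ ≡ lst ρ′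
  lst-cong {track (_ ∷ vs@(_ ∷ _)) _} {track (_ ∷ vs′@(_ ∷ _)) _} end≡ =
    just-injective (trans (sym (end-last vs)) (trans end≡ (end-last vs′)))

  -- The source of the offset between `k` and `suc k`: the internal states are read off the proper
  -- prefixes, which level 0 of `≈` does not inspect.
  label-cong : ∀ m {ρ ρ′ : Track 𝒦} → fst ρ ≡ fst ρ′ → word ρ ≈[ suc m ] word ρ′ →
               label ρ ≡ label ρ′
  label-cong m {ρ} {ρ′} fst≡ (end≡ , to , from) = cong₂ _,_ fst≡ (cong₂ _,_
    (Subset.⊆-antisym (intstates-⊆ m {ρ} {ρ′} to) (intstates-⊆ m {ρ′} {ρ} from))
    (lst-cong {ρ} {ρ′} end≡))

  fst-pref : ∀ (ρ : Track 𝒦) j → fst (pref ρ j) ≡ fst ρ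
  fst-pref (track (_ ∷ _) _) j = refl

  pref-simulates : ∀ m {ρ ρ′ : Track 𝒦} → Simulates _≈[ m ]_ (word ρ) (word ρ′) →
                   ∀ j → ∃[ j′ ] word (pref ρ j) ≈[ m ] word (pref ρ′ j′)
  pref-simulates m {track (_ ∷ vs@(_ ∷ _)) _} {track (_ ∷ _ ∷ vs′) _} f j
    with f (truncate-◁ vs j (<⇒≤ (Fin.toℕ<n j)))
  -- The one-state prefix is not in Pref(ρ′); its empty word has no last letter and so matches no
  -- nonempty one.
  ... | []     , _ , s≈[] = contradiction s≈[] (∷≉[] m _ _)
  ... | a ∷ s′ , (_ ∷ s′◁) , s≈s′ =
    let j′ , s′≡ = ◁-truncate vs′ s′◁ in j′ , subst (λ s′ → _ ≈[ m ] a ∷ s′) (s′≡ _) s≈s′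

  word≈⇒∼ : ∀ k {ρ ρ′ : Track 𝒦} → fst ρ ≡ fst ρ′ → word ρ ≈[ suc k ] word ρ′ → ρ ∼[ k ] ρ′
  word≈⇒∼ zero    {ρ} {ρ′} fst≡ ρ≈ρ′ = label-cong zero {ρ} {ρ′} fst≡ ρ≈ρ′
  word≈⇒∼ (suc k) {ρ} {ρ′} fst≡ ρ≈ρ′@(_ , to , from) =
    label-cong (suc k) {ρ} {ρ′} fst≡ ρ≈ρ′ ,
    (λ j → let j′ , s≈s′ = pref-simulates (suc k) {ρ} {ρ′} to j
           in  j′ , word≈⇒∼ k {pref ρ j} {pref ρ′ j′} (fst-pref≡ j j′) s≈s′) ,
    (λ j′ → let j , s′≈s = pref-simulates (suc k) {ρ′} {ρ} from j′
            in  j , word≈⇒∼ k {pref ρ j} {pref ρ′ j′} (fst-pref≡ j j′) (≈-sym (suc k) s′≈s))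
    where
    fst-pref≡ : ∀ j j′ → fst (pref ρ j) ≡ fst (pref ρ′ j′)
    fst-pref≡ j j′ = trans (fst-pref ρ j) (trans fst≡ (sym (fst-pref ρ′ j′)))

  Linked⇒Path : ∀ {m v} (vs : Vec W m) → Linked δ (v ∷ vs) → ∃[ w ] Path δ v (toList vs) w
  Linked⇒Path []       [-]      = _ , []
  Linked⇒Path (_ ∷ vs) (r ∷ rs) = let w , π = Linked⇒Path vs rs in w , r ∷ π

  Path⇒Linked : ∀ {v x w} → Path δ v x w → Linked δ (v ∷ fromList x)
  Path⇒Linked []      = [-]
  Path⇒Linked (r ∷ π) = r ∷ Path⇒Linked π

  short-track : ∀ k (ρ : Track 𝒦) → ∃[ ρ′ ] length ρ′ ≤ bound (suc k) ∣W∣ × ρ ∼[ k ] ρ′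
  short-track k ρ@(track (v ∷ vs@(a ∷ as)) linked)
    with contract (suc k) ∣W∣ ⊤ (≤-reflexive (Subset.∣⊤∣≡n ∣W∣)) (λ _ → Subset.∈⊤)
                  (proj₂ (Linked⇒Path vs linked))
  -- Last letters are preserved, so the contracted path keeps the two states that a track needs.
  ... | contraction {[]} _ _ vs≈[] _ = contradiction vs≈[] (∷≉[] (suc k) a (toList as))
  ... | contraction {x@(_ ∷ _)} short _ vs≈x π =
    -- The strictness of `short` accounts for the initial state `v`, which the word omits.
    track (v ∷ fromList x) (Path⇒Linked π) , short ,
    word≈⇒∼ k refl (subst (toList vs ≈[ suc k ]_) (sym (Vec.toList∘fromList x)) vs≈x)

theorem31 : (𝒦 : FiniteKripkeStructure) → let open FiniteKripkeStructure 𝒦 in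
    (k : ℕ) (ρ : Track 𝒦) →
    length ρ > τ ∣W∣ k →
    ∃[ ρ′ ] (length {𝒦} ρ′ ≤ τ ∣W∣ k × SameDescriptor k ρ ρ′)
theorem31 𝒦 k ρ _ =
  let ρ′ , short , ρ∼ρ′ = short-track k ρ
  in  ρ′ , ≤-trans short (bound≤τ _ k) , ∼⇒SameDescriptor k ρ∼ρ′
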